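{- Let $G$ be a chordal bipartite graph with $\kappa(G)=k$, where $k\ge 1$. Let $uv$ be a bisimplicial edge of $G$. Then $\kappa(G\ominus uv)\ge k-1$.
   Context: All graphs are finite and simple. A graph is bipartite if its vertex set can be partitioned into two independent sets. A bipartite graph is called chordal bipartite if every cycle of length at least six has a chord, where a chord of a cycle $C$ is an edge not in $E(C)$ both of whose end-vertices lie on $C$. $N_G(v)$ denotes the set of vertices adjacent to $v$ in $G$. An edge $uv$ of a bipartite graph $G$ is bisimplicial if $N_G(u)\cup N_G(v)$ induces in $G$ a complete bipartite graph with bipartition $(N_G(u),N_G(v))$, i.e. every vertex of $N_G(u)$ is adjacent to every vertex of $N_G(v)$. For an edge $uv$ of $G$, $G\ominus uv$ denotes $G-\{u,v\}$, the graph obtained from $G$ by deleting the vertices $u$ and $v$ together with all edges incident with them. A vertex cut of $G$ is a set $S\subseteq V(G)$ such that $G-S$ is disconnected (so $S=\emptyset$ is a vertex cut when $G$ is disconnected). The connectivity $\kappa(G)$ is the minimum size of a vertex cut if $G$ is not complete, and $|V(G)|-1$ if $G$ is complete. -}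

module Defs where

open import Data.Empty using (⊥-elim)
open import Data.Fin using (Fin; toℕ; _≟_)
open import Data.Fin.Properties using (any?; all?)
open import Data.Fin.Subset
  using (Subset; _∈_; _∉_; _⊆_; _∪_; _∩_; _─_; ⁅_⁆; ∣_∣)
  renaming (⊥ to ∅)
open import Data.Fin.Subset.Properties
  using ( _∈?_; _⊆?_; anySubset?; x∈⁅x⁆; x∈⁅y⁆⇒x≡y; x∈p∪q⁺; x∈p∪q⁻
        ; x∈p∧x∉q⇒x∈p─q; p─q⊆p )
open import Data.List using (List; []; _∷_; allFin)
open import Data.List.Membership.Propositional using () renaming (_∈_ to _∈ˡ_)
open import Data.List.Membership.Propositional.Properties using (∈-allFin)
open import Data.List.Relation.Unary.Any using (here; there)
open import Data.Nat using (ℕ; zero; suc; _≤_; _<_; _∸_)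
import Data.Nat as ℕ
open import Data.Nat.DivMod using (_mod_)
open import Data.Nat.Induction using (<-wellFounded)
open import Data.Nat.Properties using (≮⇒≥)
open import Data.Product using (∃; ∃-syntax; _×_; _,_; proj₁; proj₂)
open import Data.Sum using (_⊎_; inj₁; inj₂)
open import Data.Vec using (_∷_; here; there)
open import Induction.WellFounded using (Acc; acc)
open import Level using (0ℓ)
open import Relation.Binary.Construct.Closure.ReflexiveTransitive
  using (Star; ε; _◅_; _◅◅_)
open import Relation.Binary.Core using (Rel)
open import Relation.Binary.Definitions using (Decidable; Symmetric; Irreflexive)
open import Relation.Binary.PropositionalEquality
  using (_≡_; _≢_; refl)
open import Relation.Nullary using (¬_; Dec; yes; no)
open import Relation.Nullary.Decidable
  using (¬?; _×-dec_; _⊎-dec_; _→-dec_; map′; decidable-stable)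
open import Relation.Unary using (Pred)

-- A finite simple graph.  The vertex set V is a subset of an ambient Fin n, so
-- that deleting vertices shrinks V without renaming the remaining vertices;
-- elements of Fin n outside V are not vertices and carry no edges.
record Graph (n : ℕ) : Set₁ where
  infix 4 _~_ _~?_
  field
    V      : Subset n
    _~_    : Rel (Fin n) 0ℓ
    _~?_   : Decidable _~_
    ~-sym  : Symmetric _~_
    ~-irr  : Irreflexive _≡_ _~_
    ~⇒∈V   : ∀ {x y} → x ~ y → x ∈ V

module _ {n : ℕ} (G : Graph n) where
  open Graph G

  order : ℕ
  order = ∣ V ∣

  N : Fin n → Pred (Fin n) 0ℓ
  N v = λ x → v ~ x

  Independent : Subset n → Set
  Independent A = ∀ {x y} → x ∈ A → y ∈ A → ¬ (x ~ y)

  -- A part of the bipartition may be empty.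
  Bipartite : Set
  Bipartite = ∃[ A ] ∃[ B ]
    (A ∪ B ≡ V) × (A ∩ B ≡ ∅) × Independent A × Independent B

next : ∀ {m} → Fin m → Fin m
next {suc m} i = suc (toℕ i) mod suc m

record Cycle {n} (G : Graph n) : Set where
  open Graph G
  field
    length     : ℕ
    length≥3   : 3 ≤ length
    vertex     : Fin length → Fin n
    injective  : ∀ {i j} → vertex i ≡ vertex j → i ≡ j
    adjacent   : ∀ i → vertex i ~ vertex (next i)

  OnCycle : Fin n → Set
  OnCycle x = ∃[ i ] vertex i ≡ x

  CycleEdge : Fin n → Fin n → Set
  CycleEdge x y = ∃[ i ]
    ((vertex i ≡ x × vertex (next i) ≡ y) ⊎ (vertex i ≡ y × vertex (next i) ≡ x))

  HasChord : Set
  HasChord = ∃[ x ] ∃[ y ] (x ~ y) × ¬ CycleEdge x y × OnCycle x × OnCycle y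

ChordalBipartite : ∀ {n} → Graph n → Set
ChordalBipartite G =
  Bipartite G × (∀ (C : Cycle G) → 6 ≤ Cycle.length C → Cycle.HasChord C)

-- In a bipartite graph the neighbourhoods of adjacent u and v are automatically
-- disjoint and independent, so only completeness between them is demanded.
Bisimplicial : ∀ {n} → Graph n → Fin n → Fin n → Set
Bisimplicial G u v = (u ~ v) × (∀ {x y} → N G u x → N G v y → x ~ y)
  where open Graph G

infixl 5 _-ᴳ_
_-ᴳ_ : ∀ {n} → Graph n → Subset n → Graph n
G -ᴳ S = record
  { V     = V ─ S
  ; _~_   = λ x y → (x ~ y) × x ∉ S × y ∉ S
  ; _~?_  = λ x y → (x ~? y) ×-dec ¬? (x ∈? S) ×-dec ¬? (y ∈? S)
  ; ~-sym = λ (e , x∉ , y∉) → ~-sym e , y∉ , x∉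
  ; ~-irr = λ x≡y (e , _) → ~-irr x≡y e
  ; ~⇒∈V  = λ (e , x∉ , _) → x∈p∧x∉q⇒x∈p─q (~⇒∈V e) x∉
  } where open Graph G

infixl 5 _⊖_,_
_⊖_,_ : ∀ {n} → Graph n → Fin n → Fin n → Graph n
G ⊖ u , v = G -ᴳ (⁅ u ⁆ ∪ ⁅ v ⁆)

module _ {n : ℕ} (G : Graph n) where
  open Graph G

  Reachable : Rel (Fin n) 0ℓ
  Reachable = Star _~_

  Disconnected : Set
  Disconnected = ∃[ x ] ∃[ y ] x ∈ V × y ∈ V × ¬ Reachable x y

  Complete : Set
  Complete = ∀ x y → x ∈ V → y ∈ V → x ≢ y → x ~ y

VertexCut : ∀ {n} → Graph n → Subset n → Set
VertexCut G S = S ⊆ Graph.V G × Disconnected (G -ᴳ S)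

-- The graph without vertices is complete, and by truncated subtraction its
-- connectivity is 0.
IsConnectivity : ∀ {n} → Graph n → ℕ → Set
IsConnectivity G k =
    (Complete G × k ≡ order G ∸ 1)
  ⊎ (¬ Complete G × (∃[ S ] VertexCut G S × ∣ S ∣ ≡ k)
                  × (∀ S → VertexCut G S → k ≤ ∣ S ∣))

-- Reachability is decidable: Via zs x y says that y can be reached from x by a
-- walk all of whose interior vertices occur in zs.
module _ {n : ℕ} (G : Graph n) where
  open Graph G

  private
    Via : List (Fin n) → Rel (Fin n) 0ℓ
    Via []       x y = x ≡ y ⊎ x ~ y
    Via (z ∷ zs) x y = Via zs x y ⊎ (Via zs x z × Via zs z y)

    via? : ∀ zs → Decidable (Via zs)
    via? []       x y = (x ≟ y) ⊎-dec (x ~? y)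
    via? (z ∷ zs) x y = via? zs x y ⊎-dec (via? zs x z ×-dec via? zs z y)

    via⇒star : ∀ zs {x y} → Via zs x y → Reachable G x y
    via⇒star []       (inj₁ refl)    = ε
    via⇒star []       (inj₂ e)       = e ◅ ε
    via⇒star (z ∷ zs) (inj₁ p)       = via⇒star zs p
    via⇒star (z ∷ zs) (inj₂ (p , q)) = via⇒star zs p ◅◅ via⇒star zs q

    via-base : ∀ zs {x y} → x ≡ y ⊎ x ~ y → Via zs x y
    via-base []       p = p
    via-base (z ∷ zs) p = inj₁ (via-base zs p)

    via-trans : ∀ zs {x w y} → w ∈ˡ zs → Via zs x w → Via zs w y → Via zs x y
    via-trans (z ∷ zs) (here refl) p q = inj₂ (into p , out q)
      where
      into : ∀ {x} → Via (z ∷ zs) x z → Via zs x z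
      into (inj₁ p)       = p
      into (inj₂ (p , _)) = p
      out : ∀ {y} → Via (z ∷ zs) z y → Via zs z y
      out (inj₁ q)       = q
      out (inj₂ (_ , q)) = q
    via-trans (z ∷ zs) (there w∈) (inj₁ p)       (inj₁ q) =
      inj₁ (via-trans zs w∈ p q)
    via-trans (z ∷ zs) (there w∈) (inj₁ p)       (inj₂ (q , r)) =
      inj₂ (via-trans zs w∈ p q , r)
    via-trans (z ∷ zs) (there w∈) (inj₂ (p , q)) (inj₁ r) =
      inj₂ (p , via-trans zs w∈ q r)
    via-trans (z ∷ zs) (there w∈) (inj₂ (p , _)) (inj₂ (_ , r)) =
      inj₂ (p , r)

    star⇒via : ∀ {x y} → Reachable G x y → Via (allFin n) x y
    star⇒via ε        = via-base (allFin n) (inj₁ refl)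
    star⇒via (e ◅ es) =
      via-trans (allFin n) (∈-allFin _) (via-base (allFin n) (inj₂ e)) (star⇒via es)

  reachable? : Decidable (Reachable G)
  reachable? x y = map′ (via⇒star (allFin n)) star⇒via (via? (allFin n) x y)

  disconnected? : Dec (Disconnected G)
  disconnected? = any? λ x → any? λ y →
    (x ∈? V) ×-dec (y ∈? V) ×-dec ¬? (reachable? x y)

  complete? : Dec (Complete G)
  complete? = all? λ x → all? λ y →
    (x ∈? V) →-dec ((y ∈? V) →-dec (¬? (x ≟ y) →-dec (x ~? y)))

private
  x∈p─q⇒x∉q : ∀ {n} {x : Fin n} (p q : Subset n) → x ∈ p ─ q → x ∉ q
  x∈p─q⇒x∉q (_ ∷ p) (_ ∷ q) (there x∈p─q) (there x∈q) = x∈p─q⇒x∉q p q x∈p─q x∈q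

module _ {n : ℕ} (G : Graph n) where
  open Graph G

  vertexCut? : ∀ S → Dec (VertexCut G S)
  vertexCut? S = (S ⊆? V) ×-dec disconnected? (G -ᴳ S)

  private
    nonadjacent⇒cut : ∀ {x y} → x ∈ V → y ∈ V → x ≢ y → ¬ (x ~ y) →
                      VertexCut G (V ─ (⁅ x ⁆ ∪ ⁅ y ⁆))
    nonadjacent⇒cut {x} {y} x∈V y∈V x≢y x≁y =
      p─q⊆p V P , x , y ,
      x∈p∧x∉q⇒x∈p─q x∈V (kept (x∈p∪q⁺ (inj₁ (x∈⁅x⁆ x)))) ,
      x∈p∧x∉q⇒x∈p─q y∈V (kept (x∈p∪q⁺ (inj₂ (x∈⁅x⁆ y)))) ,
      unreachable
      where
      P = ⁅ x ⁆ ∪ ⁅ y ⁆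

      kept : ∀ {z} → z ∈ P → z ∉ V ─ P
      kept z∈P z∈V─P = x∈p─q⇒x∉q V P z∈V─P z∈P

      unreachable : ¬ Star (Graph._~_ (G -ᴳ (V ─ P))) x y
      unreachable ε = x≢y refl
      unreachable (_◅_ {j = z} (e , _ , z∉) _)
        with z ∈? P
      ... | no z∉P = z∉ (x∈p∧x∉q⇒x∈p─q (~⇒∈V (~-sym e)) z∉P)
      ... | yes z∈P with x∈p∪q⁻ ⁅ x ⁆ ⁅ y ⁆ z∈P
      ...   | inj₁ z∈x with refl ← x∈⁅y⁆⇒x≡y x z∈x = ~-irr refl e
      ...   | inj₂ z∈y with refl ← x∈⁅y⁆⇒x≡y y z∈y = x≁y e

    hasCut : ¬ Complete G → ∃ (VertexCut G)
    hasCut ¬complete with anySubset? vertexCut?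
    ... | yes cut = cut
    ... | no ¬cut = ⊥-elim (¬complete λ x y x∈V y∈V x≢y →
      decidable-stable (x ~? y) λ x≁y → ¬cut (_ , nonadjacent⇒cut x∈V y∈V x≢y x≁y))

    minimumCut : ∀ S → VertexCut G S → Acc _<_ ∣ S ∣ →
                 ∃[ T ] VertexCut G T × (∀ U → VertexCut G U → ∣ T ∣ ≤ ∣ U ∣)
    minimumCut S cut (acc rec)
      with anySubset? (λ T → vertexCut? T ×-dec (∣ T ∣ ℕ.<? ∣ S ∣))
    ... | yes (T , cut′ , T<S) = minimumCut T cut′ (rec T<S)
    ... | no  none = S , cut , λ U cutU → ≮⇒≥ λ U<S → none (U , cutU , U<S)

  connectivity : ∃ (IsConnectivity G)
  connectivity with complete? G
  ... | yes complete = _ , inj₁ (complete , refl)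
  ... | no ¬complete =
    let S , cut           = hasCut ¬complete
        T , cutT , minimum = minimumCut S cut (<-wellFounded ∣ S ∣)
    in ∣ T ∣ , inj₂ (¬complete , (T , cutT , refl) , minimum)

  κ : ℕ
  κ = proj₁ connectivity

  κ-isConnectivity : IsConnectivity G κ
  κ-isConnectivity = proj₂ connectivity

{-# OPTIONS --safe #-}

-- Let S be a minimum vertex cut of H = G ⊖ u , v.  If u and v both keep a
-- neighbour, say a and b, in H - S, then u ↦ b, v ↦ a retracts G - S onto H - S
-- without joining components, since N(u) and N(v) are completely joined; hence S
-- is a cut of G.  Otherwise one of u, v becomes isolated once the other is
-- deleted together with S, so S and that other vertex form a cut of G.
module Submission where

open import Defs
open import Data.Fin using (Fin; _≟_)
open import Data.Fin.Properties using (any?)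
open import Data.Fin.Subset
  using (Subset; inside; outside; _∈_; _∉_; _⊆_; _∪_; _─_; _-_; ⁅_⁆; ∣_∣)
open import Data.Fin.Subset.Properties
  using ( _∈?_; x∈⁅x⁆; x∈⁅y⁆⇒x≡y; ∣⁅x⁆∣≡1; x∈p∪q⁺; x∈p∪q⁻; ∣p∣≤∣x∷p∣; p⊆q⇒∣p∣≤∣q∣
        ; p─q⊆p; x∈p∧x∉q⇒x∈p─q; x∈p∧x≢y⇒x∈p-y; x∈p⇒∣p-x∣<∣p∣ )
open import Data.Nat using (ℕ; suc; _≥_; _∸_; _≤_; _+_; z≤n; s≤s)
open import Data.Nat.Properties
  using ( module ≤-Reasoning; ≤-refl; ≤-reflexive; ≤-trans; +-comm; +-suc; +-monoʳ-≤
        ; +-cancelʳ-≤; ∸-monoˡ-≤; m≤m+n; m≤n+o⇒m∸n≤o )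
open import Data.Product using (∃-syntax; _×_; _,_)
open import Data.Sum using (_⊎_; inj₁; inj₂; [_,_]′)
open import Data.Vec using ([]; _∷_; there)
open import Function using (_∘_; id)
open import Relation.Binary.Construct.Closure.ReflexiveTransitive
  using (ε; return; kleisliStar)
open import Relation.Binary.PropositionalEquality
  using (_≡_; _≢_; refl; sym; subst; subst₂)
open import Relation.Nullary using (¬_; Dec; yes; no; contradiction)
open import Relation.Nullary.Decidable using (¬?; _×-dec_; _⊎-dec_; decidable-stable)

x∈p─q⇒x∉q : ∀ {n} {x : Fin n} (p q : Subset n) → x ∈ p ─ q → x ∉ q
x∈p─q⇒x∉q (_ ∷ p) (_ ∷ q) (there x∈p─q) (there x∈q) = x∈p─q⇒x∉q p q x∈p─q x∈q

∣p∪q∣≤∣p∣+∣q∣ : ∀ {n} (p q : Subset n) → ∣ p ∪ q ∣ ≤ ∣ p ∣ + ∣ q ∣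
∣p∪q∣≤∣p∣+∣q∣ []            []            = ≤-refl
∣p∪q∣≤∣p∣+∣q∣ (outside ∷ p) (outside ∷ q) = ∣p∪q∣≤∣p∣+∣q∣ p q
∣p∪q∣≤∣p∣+∣q∣ (outside ∷ p) (inside  ∷ q) =
  ≤-trans (s≤s (∣p∪q∣≤∣p∣+∣q∣ p q)) (≤-reflexive (sym (+-suc ∣ p ∣ ∣ q ∣)))
∣p∪q∣≤∣p∣+∣q∣ (inside  ∷ p) (y       ∷ q) =
  s≤s (≤-trans (∣p∪q∣≤∣p∣+∣q∣ p q) (+-monoʳ-≤ ∣ p ∣ (∣p∣≤∣x∷p∣ y q)))

∣p∪⁅x⁆∣≤∣p∣+1 : ∀ {n} (p : Subset n) x → ∣ p ∪ ⁅ x ⁆ ∣ ≤ ∣ p ∣ + 1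
∣p∪⁅x⁆∣≤∣p∣+1 p x =
  subst (λ m → ∣ p ∪ ⁅ x ⁆ ∣ ≤ ∣ p ∣ + m) (∣⁅x⁆∣≡1 x) (∣p∪q∣≤∣p∣+∣q∣ p ⁅ x ⁆)

∣⁅x⁆∪⁅y⁆∣≤2 : ∀ {n} (x y : Fin n) → ∣ ⁅ x ⁆ ∪ ⁅ y ⁆ ∣ ≤ 2
∣⁅x⁆∪⁅y⁆∣≤2 x y =
  subst (λ m → ∣ ⁅ x ⁆ ∪ ⁅ y ⁆ ∣ ≤ m + 1) (∣⁅x⁆∣≡1 x) (∣p∪⁅x⁆∣≤∣p∣+1 ⁅ x ⁆ y)

∣p∣≤∣p─q∣+∣q∣ : ∀ {n} (p q : Subset n) → ∣ p ∣ ≤ ∣ p ─ q ∣ + ∣ q ∣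
∣p∣≤∣p─q∣+∣q∣ p q = ≤-trans (p⊆q⇒∣p∣≤∣q∣ p⊆p─q∪q) (∣p∪q∣≤∣p∣+∣q∣ (p ─ q) q)
  where
  p⊆p─q∪q : p ⊆ (p ─ q) ∪ q
  p⊆p─q∪q {x} x∈p with x ∈? q
  ... | yes x∈q = x∈p∪q⁺ (inj₂ x∈q)
  ... | no  x∉q = x∈p∪q⁺ (inj₁ (x∈p∧x∉q⇒x∈p─q x∈p x∉q))

∉-pair : ∀ {n} {x y z : Fin n} → z ≢ x → z ≢ y → z ∉ ⁅ x ⁆ ∪ ⁅ y ⁆
∉-pair z≢x z≢y z∈ with x∈p∪q⁻ _ _ z∈
... | inj₁ z∈x = z≢x (x∈⁅y⁆⇒x≡y _ z∈x)
... | inj₂ z∈y = z≢y (x∈⁅y⁆⇒x≡y _ z∈y)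

module _ {n : ℕ} (G : Graph n) where
  open Graph G

  -- By pigeonhole two of the three vertices share a side, and sides are independent.
  bipartite⇒triangle-free : Bipartite G → ∀ {x y z} → x ~ y → y ~ z → ¬ (x ~ z)
  bipartite⇒triangle-free (A , B , A∪B≡V , _ , indA , indB) xy yz xz
    with side (~⇒∈V xy) | side (~⇒∈V yz) | side (~⇒∈V (~-sym xz))
    where
    side : ∀ {w} → w ∈ V → w ∈ A ⊎ w ∈ B
    side w∈V = x∈p∪q⁻ A B (subst (_ ∈_) (sym A∪B≡V) w∈V)
  ... | inj₁ x | inj₁ y | _      = indA x y xy
  ... | inj₁ x | inj₂ y | inj₁ z = indA x z xz
  ... | inj₁ x | inj₂ y | inj₂ z = indB y z yz
  ... | inj₂ x | inj₂ y | _      = indB x y xy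
  ... | inj₂ x | inj₁ y | inj₁ z = indA y z yz
  ... | inj₂ x | inj₁ y | inj₂ z = indB x z xz

  -- In a complete graph any third vertex would form a triangle with `u` and `v`.
  complete-bipartite⇒order≤2 : Bipartite G → Complete G → ∀ {u v} → u ~ v → order G ≤ 2
  complete-bipartite⇒order≤2 bip complete {u} {v} uv =
    ≤-trans (p⊆q⇒∣p∣≤∣q∣ V⊆uv) (∣⁅x⁆∪⁅y⁆∣≤2 u v)
    where
    V⊆uv : V ⊆ ⁅ u ⁆ ∪ ⁅ v ⁆
    V⊆uv {w} w∈V = decidable-stable (w ∈? ⁅ u ⁆ ∪ ⁅ v ⁆) λ w∉ →
      bipartite⇒triangle-free bip uv
        (complete v w (~⇒∈V (~-sym uv)) w∈V
          λ { refl → w∉ (x∈p∪q⁺ (inj₂ (x∈⁅x⁆ v))) })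
        (complete u w (~⇒∈V uv) w∈V
          λ { refl → w∉ (x∈p∪q⁺ (inj₁ (x∈⁅x⁆ u))) })

  -- The two separated vertices lie in `V` outside `S`, and they are distinct because the empty walk
  -- joins a vertex to itself.
  vertexCut-size : ∀ {S} → VertexCut G S → ∣ S ∣ + 2 ≤ order G
  vertexCut-size {S} (S⊆V , x , y , x∈ , y∈ , unreachable) = begin
    ∣ S ∣ + 2             ≡⟨ +-comm ∣ S ∣ 2 ⟩
    suc (suc ∣ S ∣)       ≤⟨ s≤s (s≤s (p⊆q⇒∣p∣≤∣q∣ S⊆)) ⟩
    suc (suc ∣ V - x - y ∣) ≤⟨ s≤s (x∈p⇒∣p-x∣<∣p∣ y∈V-x) ⟩
    suc ∣ V - x ∣         ≤⟨ x∈p⇒∣p-x∣<∣p∣ (p─q⊆p V S x∈) ⟩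
    ∣ V ∣                 ∎
    where
    open ≤-Reasoning

    y∈V-x : y ∈ V - x
    y∈V-x = x∈p∧x≢y⇒x∈p-y (p─q⊆p V S y∈) λ { refl → unreachable ε }

    S⊆ : S ⊆ V - x - y
    S⊆ z∈S = x∈p∧x≢y⇒x∈p-y
      (x∈p∧x≢y⇒x∈p-y (S⊆V z∈S) λ { refl → x∈p─q⇒x∉q V S x∈ z∈S })
      λ { refl → x∈p─q⇒x∉q V S y∈ z∈S }

  -- Two vertices separated by `S` avoid both `P` and `S`, so they survive the deletion of `T` and
  -- are fixed by `f`. A walk joining them in `G -ᴳ T` would be carried by `f`, edge by edge, to a
  -- walk joining them in `G -ᴳ P -ᴳ S`.
  vertexCut-lift : ∀ {P S T} → VertexCut (G -ᴳ P) S →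
                   T ⊆ V → (∀ {z} → z ∈ T → z ∈ P ⊎ z ∈ S) →
                   (f : Fin n → Fin n) → (∀ {z} → z ∉ P → f z ≡ z) →
                   (∀ {x y} → Graph._~_ (G -ᴳ T) x y →
                              Reachable (G -ᴳ P -ᴳ S) (f x) (f y)) →
                   VertexCut G T
  vertexCut-lift {P} {S} {T} (_ , x , y , x∈ , y∈ , unreachable) T⊆V T⊆P∪S f fix edge =
    T⊆V , x , y , kept x∈ , kept y∈ , λ path →
      unreachable (subst₂ (Reachable (G -ᴳ P -ᴳ S)) (fix (∉P x∈)) (fix (∉P y∈))
                          (kleisliStar f edge path))
    where
    ∉P : ∀ {z} → z ∈ V ─ P ─ S → z ∉ P
    ∉P = x∈p─q⇒x∉q V P ∘ p─q⊆p (V ─ P) S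

    kept : ∀ {z} → z ∈ V ─ P ─ S → z ∈ V ─ T
    kept z∈ = x∈p∧x∉q⇒x∈p─q (p─q⊆p V P (p─q⊆p (V ─ P) S z∈))
      ([ ∉P z∈ , x∈p─q⇒x∉q (V ─ P) S z∈ ]′ ∘ T⊆P∪S)

  -- Deleting `w` together with `S` leaves every other vertex of `P` isolated. The remaining edges
  -- therefore avoid `P`, and the identity serves as the map to lift along.
  isolating-cut : ∀ {P S w} → VertexCut (G -ᴳ P) S → w ∈ P → w ∈ V →
                  (∀ {p y} → p ∈ P → p ≢ w → p ~ y → y ≡ w ⊎ y ∈ S) →
                  VertexCut G (S ∪ ⁅ w ⁆)
  isolating-cut {P} {S} {w} cut@(S⊆ , _) w∈P w∈V isolated =
    vertexCut-lift cut T⊆V T⊆P∪S id (λ _ → refl)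
      λ (xy , x∉ , y∉) → return
        ((xy , ∉P xy x∉ y∉ , ∉P (~-sym xy) y∉ x∉) , x∉ ∘ S⊆T , y∉ ∘ S⊆T)
    where
    T = S ∪ ⁅ w ⁆

    S⊆T : S ⊆ T
    S⊆T = x∈p∪q⁺ ∘ inj₁

    w∈T : w ∈ T
    w∈T = x∈p∪q⁺ (inj₂ (x∈⁅x⁆ w))

    T⊆V : T ⊆ V
    T⊆V z∈ with x∈p∪q⁻ S ⁅ w ⁆ z∈
    ... | inj₁ z∈S = p─q⊆p V P (S⊆ z∈S)
    ... | inj₂ z∈w = subst (_∈ V) (sym (x∈⁅y⁆⇒x≡y w z∈w)) w∈V

    T⊆P∪S : ∀ {z} → z ∈ T → z ∈ P ⊎ z ∈ S
    T⊆P∪S z∈ with x∈p∪q⁻ S ⁅ w ⁆ z∈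
    ... | inj₁ z∈S = inj₂ z∈S
    ... | inj₂ z∈w = inj₁ (subst (_∈ P) (sym (x∈⁅y⁆⇒x≡y w z∈w)) w∈P)

    -- An endpoint in `P` differs from `w`, which is in `T`; its neighbours then all lie in `T`,
    -- against `y ∉ T`.
    ∉P : ∀ {x y} → x ~ y → x ∉ T → y ∉ T → x ∉ P
    ∉P xy x∉ y∉ x∈P with isolated x∈P (λ { refl → x∉ w∈T }) xy
    ... | inj₁ refl = y∉ w∈T
    ... | inj₂ y∈S  = y∉ (S⊆T y∈S)

  -- Such an `a` is a vertex of `G ⊖ u , v -ᴳ S`: irreflexivity already gives `a ≢ u`.
  PrivateNeighbour : Fin n → Fin n → Subset n → Fin n → Set
  PrivateNeighbour u v S a = u ~ a × a ≢ v × a ∉ S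

  privateNeighbour? : ∀ u v S → Dec (∃[ a ] PrivateNeighbour u v S a)
  privateNeighbour? u v S = any? λ a → (u ~? a) ×-dec ¬? (a ≟ v) ×-dec ¬? (a ∈? S)

  neighbours-covered : ∀ {u v S} → ¬ (∃[ a ] PrivateNeighbour u v S a) →
                       ∀ {y} → u ~ y → y ≡ v ⊎ y ∈ S
  neighbours-covered {u} {v} {S} none {y} uy =
    decidable-stable ((y ≟ v) ⊎-dec (y ∈? S)) λ uncovered →
      none (y , uy , uncovered ∘ inj₁ , uncovered ∘ inj₂)

  bisimplicial-cut : ∀ {u v S} → Bisimplicial G u v → VertexCut (G ⊖ u , v) S →
                     ∃[ T ] VertexCut G T × ∣ T ∣ ≤ ∣ S ∣ + 1
  bisimplicial-cut {u} {v} {S} (uv , joined) cut@(S⊆ , _)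
    with privateNeighbour? u v S | privateNeighbour? v u S
  -- All neighbours of `u` lie in `S` or equal `v`, so removing `v` as well isolates `u`. The next
  -- case exchanges the roles of `u` and `v`.
  ... | no none | _ = S ∪ ⁅ v ⁆ , isolating-cut cut
    (x∈p∪q⁺ (inj₂ (x∈⁅x⁆ v))) (~⇒∈V (~-sym uv)) isolated , ∣p∪⁅x⁆∣≤∣p∣+1 S v
    where
    isolated : ∀ {p y} → p ∈ ⁅ u ⁆ ∪ ⁅ v ⁆ → p ≢ v → p ~ y → y ≡ v ⊎ y ∈ S
    isolated p∈ p≢v with x∈p∪q⁻ ⁅ u ⁆ ⁅ v ⁆ p∈
    ... | inj₁ p∈u with refl ← x∈⁅y⁆⇒x≡y u p∈u = neighbours-covered none
    ... | inj₂ p∈v = contradiction (x∈⁅y⁆⇒x≡y v p∈v) p≢v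
  ... | yes _ | no none = S ∪ ⁅ u ⁆ , isolating-cut cut
    (x∈p∪q⁺ (inj₁ (x∈⁅x⁆ u))) (~⇒∈V uv) isolated , ∣p∪⁅x⁆∣≤∣p∣+1 S u
    where
    isolated : ∀ {p y} → p ∈ ⁅ u ⁆ ∪ ⁅ v ⁆ → p ≢ u → p ~ y → y ≡ u ⊎ y ∈ S
    isolated p∈ p≢u with x∈p∪q⁻ ⁅ u ⁆ ⁅ v ⁆ p∈
    ... | inj₁ p∈u = contradiction (x∈⁅y⁆⇒x≡y u p∈u) p≢u
    ... | inj₂ p∈v with refl ← x∈⁅y⁆⇒x≡y v p∈v = neighbours-covered none
  ... | yes (a , ua , a≢v , a∉S) | yes (b , vb , b≢u , b∉S) =
    S , vertexCut-lift cut (p─q⊆p V _ ∘ S⊆) inj₂ retract fixed edge , m≤m+n ∣ S ∣ 1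
    where
    -- The replacements are crossed: `b`, a neighbour of `v`, is adjacent to all of `N G u` and so
    -- can stand in for `u`; likewise `a` for `v`.
    retract : Fin n → Fin n
    retract z with z ≟ u | z ≟ v
    ... | yes _ | _     = b
    ... | no _  | yes _ = a
    ... | no _  | no _  = z

    fixed : ∀ {z} → z ∉ ⁅ u ⁆ ∪ ⁅ v ⁆ → retract z ≡ z
    fixed {z} z∉ with z ≟ u | z ≟ v
    ... | yes refl | _        = contradiction (x∈p∪q⁺ (inj₁ (x∈⁅x⁆ u))) z∉
    ... | no _     | yes refl = contradiction (x∈p∪q⁺ (inj₂ (x∈⁅x⁆ v))) z∉
    ... | no _     | no _     = refl

    a≢u : a ≢ u
    a≢u refl = ~-irr refl ua

    b≢v : b ≢ v
    b≢v refl = ~-irr refl vb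

    step : ∀ {x y} → x ~ y → x ≢ u → x ≢ v → x ∉ S → y ≢ u → y ≢ v → y ∉ S →
           Reachable (G ⊖ u , v -ᴳ S) x y
    step xy x≢u x≢v x∉S y≢u y≢v y∉S =
      return ((xy , ∉-pair x≢u x≢v , ∉-pair y≢u y≢v) , x∉S , y∉S)

    edge : ∀ {x y} → Graph._~_ (G -ᴳ S) x y →
           Reachable (G ⊖ u , v -ᴳ S) (retract x) (retract y)
    edge {x} {y} (xy , x∉S , y∉S) with x ≟ u | x ≟ v | y ≟ u | y ≟ v
    -- There are no loops at `u`, so this case never arises; as both ends retract to `b`, the empty
    -- walk settles it. The same holds for `v` below.
    ... | yes refl | _        | yes refl | _        = ε
    ... | yes refl | _        | no _     | yes refl =
      step (~-sym (joined ua vb)) b≢u b≢v b∉S a≢u a≢v a∉S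
    ... | yes refl | _        | no y≢u   | no y≢v   =
      step (~-sym (joined xy vb)) b≢u b≢v b∉S y≢u y≢v y∉S
    ... | no _     | yes refl | yes refl | _        =
      step (joined ua vb) a≢u a≢v a∉S b≢u b≢v b∉S
    ... | no _     | yes refl | no _     | yes refl = ε
    ... | no _     | yes refl | no y≢u   | no y≢v   =
      step (joined ua xy) a≢u a≢v a∉S y≢u y≢v y∉S
    ... | no x≢u   | no x≢v   | yes refl | _        =
      step (joined (~-sym xy) vb) x≢u x≢v x∉S b≢u b≢v b∉S
    ... | no x≢u   | no x≢v   | no _     | yes refl =
      step (~-sym (joined ua (~-sym xy))) x≢u x≢v x∉S a≢u a≢v a∉S
    ... | no x≢u   | no x≢v   | no y≢u   | no y≢v   =
      step xy x≢u x≢v x∉S y≢u y≢v y∉S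

  -- Working with `IsConnectivity` instead of `κ` lets the proof split on which of the two graphs is
  -- complete.
  connectivity-⊖ : ∀ {u v k l} → Bipartite G → Bisimplicial G u v →
                   IsConnectivity G k → IsConnectivity (G ⊖ u , v) l → k ∸ 1 ≤ l
  -- Here `k` is at most 1, so `k ∸ 1` is 0.
  connectivity-⊖ {u} {v} {l = l} bip (uv , _) (inj₁ (complete , refl)) _ = begin
    order G ∸ 1 ∸ 1 ≤⟨ ∸-monoˡ-≤ 1 (∸-monoˡ-≤ 1 order≤2) ⟩
    0               ≤⟨ z≤n ⟩
    l               ∎
    where
    open ≤-Reasoning
    order≤2 = complete-bipartite⇒order≤2 bip complete uv
  -- When `G ⊖ u , v` is complete, counting suffices: `k` is the size of a cut, hence at most the
  -- order of `G` minus 2. This is at most the order of `G ⊖ u , v`, from which `l` is obtained by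
  -- subtracting 1.
  connectivity-⊖ {u} {v} _ _ (inj₂ (_ , (S , cut , refl) , _)) (inj₁ (_ , refl)) =
    ∸-monoˡ-≤ 1 (+-cancelʳ-≤ 2 _ _ (begin
      ∣ S ∣ + 2         ≤⟨ vertexCut-size cut ⟩
      ∣ V ∣             ≤⟨ ∣p∣≤∣p─q∣+∣q∣ V P ⟩
      ∣ V ─ P ∣ + ∣ P ∣ ≤⟨ +-monoʳ-≤ ∣ V ─ P ∣ (∣⁅x⁆∪⁅y⁆∣≤2 u v) ⟩
      ∣ V ─ P ∣ + 2     ∎))
    where
    open ≤-Reasoning
    P = ⁅ u ⁆ ∪ ⁅ v ⁆
  -- A minimum cut of `G ⊖ u , v` yields a cut of `G` with at most one more vertex, whose size
  -- bounds `k` from above.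
  connectivity-⊖ _ bis (inj₂ (_ , _ , minimum)) (inj₂ (_ , (S , cut , refl) , _)) =
    let T , cutT , ∣T∣≤ = bisimplicial-cut bis cut
    in m≤n+o⇒m∸n≤o _ 1 (≤-trans (minimum T cutT)
         (≤-trans ∣T∣≤ (≤-reflexive (+-comm ∣ S ∣ 1))))

lemma2p5 : ∀ {n} (G : Graph n) (k : ℕ) → ChordalBipartite G → κ G ≡ k → k ≥ 1 →
    ∀ u v → Bisimplicial G u v → κ (G ⊖ u , v) ≥ k ∸ 1
lemma2p5 G _ (bip , _) refl _ u v bis =
  connectivity-⊖ G bip bis (κ-isConnectivity G) (κ-isConnectivity (G ⊖ u , v))
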